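{- There is a fixed polynomial $p$ such that for every constant $\varepsilon>0$, every Abelian group $G$, every $n\ge1$ and every function $f:\{0,1\}^n\to G$, the number of polynomials $P\in\mathcal{P}_1(\{0,1\}^n,G)$ with $\delta(f,P)\le \frac12-\varepsilon$ is at most $p(1/\varepsilon)$; i.e. $\mathcal{P}_1$ is $(\frac12-\varepsilon,\mathrm{poly}(1/\varepsilon))$-list decodable.
   Context: $\mathcal{P}_1(\{0,1\}^n,G)$ is the set of functions $P(x)=a_0+\sum_{i=1}^n a_ix_i$ with $a_i\in G$, where $x\in\{0,1\}^n$ and $\{0,1\}\subseteq\mathbb{Z}$. $\delta(f,P)=\Pr_{x\sim\{0,1\}^n}[f(x)\ne P(x)]$. A class $\mathcal{F}$ is $(\delta,L)$-list decodable if for every $f$ at most $L$ elements of $\mathcal{F}$ are $\delta$-close to $f$. -}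

module Defs where

open import Level using (Level; _⊔_; Setω)
open import Algebra.Bundles using (AbelianGroup)
open import Data.Bool using (Bool; true; false; if_then_else_)
open import Data.Nat as ℕ using (ℕ; zero; suc)
open import Data.Vec using (Vec; []; _∷_)
open import Data.List using (List; []; _∷_; map; _++_; length; filter)
open import Data.Product using (Σ; _×_; _,_)
open import Data.Rational using (ℚ; 0ℚ; _+_; _*_; _≤_; _/_)
open import Data.Integer using (+_)
open import Relation.Nullary using (¬_)
open import Relation.Binary.PropositionalEquality using (_≡_)
open import Relation.Unary using (Pred)
open import Data.Bool.Properties using () renaming (T? to T?)
open import Data.Bool using (T)
open import Data.List.Relation.Unary.All using (All)
open import Data.List.Relation.Unary.AllPairs using (AllPairs)

Cube : ℕ → Set
Cube n = Vec Bool n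

allPoints : (n : ℕ) → List (Cube n)
allPoints zero = [] ∷ []
allPoints (suc n) = map (false ∷_) (allPoints n) ++ map (true ∷_) (allPoints n)

count : (n : ℕ) → (Cube n → Bool) → ℕ
count n S = length (filter (λ x → T? (S x)) (allPoints n))

toℚ : ℕ → ℚ
toℚ k = (+ k) / 1

evalPoly : List ℚ → ℚ → ℚ
evalPoly [] x = 0ℚ
evalPoly (c ∷ cs) x = c + x * evalPoly cs x

module _ {c ℓ : Level} (G : AbelianGroup c ℓ) where
  open AbelianGroup G renaming (Carrier to A)

  -- A degree-≤1 polynomial a₀ + Σ aᵢ xᵢ, given by its coefficients.
  Lin : ℕ → Set c
  Lin n = A × Vec A n

  -- Σ_i aᵢ xᵢ with xᵢ ∈ {0,1} ⊆ ℤ (so xᵢ aᵢ = aᵢ if xᵢ = 1, and 0 otherwise).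
  linSum : ∀ {n} → Vec A n → Cube n → A
  linSum [] [] = ε
  linSum (a ∷ as) (b ∷ bs) = (if b then a else ε) ∙ linSum as bs

  evalLin : ∀ {n} → Lin n → Cube n → A
  evalLin (a₀ , as) x = a₀ ∙ linSum as x

  SameFun : ∀ {n} → Lin n → Lin n → Set ℓ
  SameFun P Q = ∀ x → evalLin P x ≈ evalLin Q x

  -- δ(f,P) ≤ η, i.e.  #{x : f x ≠ P x} ≤ η · 2^n.
  -- The disagreement set is witnessed by a subset S ⊆ {0,1}^n containing it
  -- (outside S, f and P agree); then #S ≤ η·2^n.
  DistLe : (n : ℕ) → (Cube n → A) → Lin n → ℚ → Set ℓ
  DistLe n f P η =
    Σ (Cube n → Bool) λ S →
      (∀ x → S x ≡ false → f x ≈ evalLin P x) ×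
      (toℚ (count n S) ≤ η * toℚ (2 ℕ.^ n))

  -- At most L (a rational bound) elements of 𝒫₁({0,1}^n,G) are η-close to f:
  -- every list of pairwise distinct such polynomials has length ≤ L.
  AtMostCloseTo : (n : ℕ) → (Cube n → A) → ℚ → ℚ → Set (c ⊔ ℓ)
  AtMostCloseTo n f η L =
    (Ps : List (Lin n)) →
    AllPairs (λ P Q → ¬ SameFun P Q) Ps →
    All (λ P → DistLe n f P η) Ps →
    toℚ (length Ps) ≤ L

-- Existential over a Setω-valued body (needed because the polynomial is chosen
-- before quantifying over groups of all universe levels).
record ∃Poly (B : List ℚ → Setω) : Setω where
  constructor _,_
  field
    poly : List ℚ
    holds : B poly

{-# OPTIONS --safe #-}
module Submission where

-- Write N = 2ⁿ and let a(P) be the number of points where f and P agree.  Over all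
-- affine functions P, one has the Parseval-like inequality
--     Σ_P max(0, 2a(P) − N)² ≤ N²,
-- and every P with δ(f,P) ≤ ½ − ε contributes at least (2εN)², so there are at most
-- 1/(4ε²) of them.  The inequality is proved by induction on n.  An affine P splits
-- into its restrictions P₀, P₁ to the two halves of the cube, and the contribution of
-- P is charged partly to P₀ and partly to P₁.  The P that share the same P₀ have
-- restrictions P₁ differing by constants, so these P₁ agree with f on disjoint sets;
-- by convexity the charges received by P₀ then total at most twice its own
-- contribution max(0, 2a(P₀) − 2ⁿ⁻¹)².

open import Defs
open import Level using (Level; _⊔_)
open import Algebra.Bundles using (AbelianGroup)
open import Data.Bool using (Bool; true; false; T; not; if_then_else_)
open import Data.Bool.Properties using (T?)
open import Data.Fin using (Fin; zero; suc)
import Data.Integer as ℤ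
import Data.Integer.Properties as ℤ
open import Data.List using (List; []; _∷_; map; filter; length; lookup; allFin; _++_)
open import Data.List.Membership.Propositional.Properties using (∈-lookup)
open import Data.List.Properties using (filter-++; length-++; map-tabulate; tabulate-lookup; length-tabulate)
open import Data.List.Relation.Unary.All as All using (All; []; _∷_)
open import Data.List.Relation.Unary.All.Properties using (¬All⇒Any¬; ¬Any⇒All¬; all-filter)
open import Data.List.Relation.Unary.AllPairs as AllPairs using (AllPairs; []; _∷_)
import Data.List.Relation.Unary.AllPairs.Properties as AllPairsₚ
open import Data.List.Relation.Unary.Any as Any using (Any; here; there)
open import Data.Nat as ℕ using (ℕ; zero; suc; _+_; _*_; _∸_; _^_; _≤_; z≤n; s≤s; NonZero)
import Data.Nat.Coprimality as Coprime
open import Data.Nat.ListAction using (sum)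
open import Data.Nat.Properties
open import Data.Nat.Tactic.RingSolver using (solve-∀)
open import Data.Product using (Σ; _×_; _,_; proj₁)
open import Data.Rational as ℚ using (ℚ; 0ℚ; 1ℚ; ½; mkℚ; _-_; 1/_; Positive; NonNegative)
open import Data.Rational.Properties using (pos⇒nonZero)
import Data.Rational.Properties as ℚ
open import Data.Rational.Solver using (module +-*-Solver)
open import Data.Sum using (_⊎_; inj₁; inj₂)
open import Data.Unit.Polymorphic using (⊤; tt)
open import Data.Vec using (Vec; []; _∷_)
open import Function using (_∘_)
open import Relation.Binary using (Rel; Reflexive; Symmetric; Decidable)
open import Relation.Binary.PropositionalEquality using (_≡_; refl; sym; trans; cong; cong₂; subst; module ≡-Reasoning)
open import Relation.Nullary using (¬_; Dec; yes; no; contradiction)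
open import Relation.Nullary.Decidable using (map′; _×-dec_; toWitness; fromWitness; ⌊_⌋; decidable-stable; ¬¬-excluded-middle)

private
  variable
    ℓ₁ ℓ₂ : Level
    I : Set ℓ₁

-- Excesses and charges

sq : ℕ → ℕ
sq x = x * x

sq-mono : ∀ {x y} → x ≤ y → sq x ≤ sq y
sq-mono x≤y = *-mono-≤ x≤y x≤y

2*m≡m+m : ∀ m → 2 * m ≡ m + m
2*m≡m+m m = cong (m +_) (+-identityʳ m)

-- With `a` agreements among `N` points, this is the positive part of agreements minus
-- disagreements.
excess : ℕ → ℕ → ℕ
excess N a = 2 * a ∸ N

-- The share charged to a restriction of bias B when the other restriction agrees with f
-- in a of N points.  Without truncation and with c = 2a − N, the cases are (B + c)² for
-- c ≤ 0 and 2B² − (B − c)² for c > 0; the latter makes (b + c)² the sum of the two charges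
-- when b, c > 0 are the two biases.
charge : ℕ → ℕ → ℕ → ℕ
charge N B a with 2 * a ≤? N
... | yes _ = sq (2 * a ∸ (N ∸ B))
... | no  _ = 2 * sq B ∸ sq (B ∸ excess N a)

charge-light : ∀ N B a → 2 * a ≤ N → charge N B a ≡ sq (2 * a ∸ (N ∸ B))
charge-light N B a light with 2 * a ≤? N
... | yes _     = refl
... | no  heavy = contradiction light heavy

charge-heavy : ∀ N B a → N ℕ.< 2 * a → charge N B a ≡ 2 * sq B ∸ sq (B ∸ excess N a)
charge-heavy N B a heavy with 2 * a ≤? N
... | yes light = contradiction heavy (≤⇒≯ light)
... | no  _     = refl

excess-+ : ∀ {N} a b → N ≤ 2 * a → N ≤ 2 * b → excess (2 * N) (a + b) ≡ excess N a + excess N b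
excess-+ {N} a b N≤2a N≤2b = begin
  2 * (a + b) ∸ 2 * N             ≡⟨ cong (_∸ 2 * N) (*-distribˡ-+ 2 a b) ⟩
  2 * a + 2 * b ∸ 2 * N           ≡⟨ cong₂ (λ u v → u + v ∸ 2 * N) (m+[n∸m]≡n N≤2a) (m+[n∸m]≡n N≤2b) ⟨
  (N + x) + (N + y) ∸ 2 * N       ≡⟨ cong (_∸ 2 * N) (regroup N x y) ⟩
  2 * N + (x + y) ∸ 2 * N         ≡⟨ m+n∸m≡n (2 * N) (x + y) ⟩
  x + y                           ∎
  where
  open ≡-Reasoning
  x = excess N a
  y = excess N b
  regroup : ∀ N x y → (N + x) + (N + y) ≡ 2 * N + (x + y)
  regroup = solve-∀

-- Write `y = x + d`. The smaller bias gets `2x²`, because `x ∸ y` vanishes, and the larger gets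
-- `2(x + d)² - d² = 2x² + 4xd + d²`; together they make `(2x + d)²`.
sq-+-ordered : ∀ {x y} → x ≤ y →
               sq (x + y) ≡ (2 * sq x ∸ sq (x ∸ y)) + (2 * sq y ∸ sq (y ∸ x))
sq-+-ordered {x} {y} x≤y = begin
  sq (x + y)                                    ≡⟨ cong (λ v → sq (x + v)) y≡x+d ⟩
  sq (x + (x + d))                              ≡⟨ expand x d ⟩
  2 * sq x + (sq d + (2 * sq x + 4 * (x * d)))  ≡⟨ cong (2 * sq x +_) (m+n∸n≡m _ (sq d)) ⟨
  2 * sq x + (sq d + (2 * sq x + 4 * (x * d)) + sq d ∸ sq d)
    ≡⟨ cong (λ v → 2 * sq x + (v ∸ sq d)) (collect x d) ⟩
  2 * sq x + (2 * sq (x + d) ∸ sq d)            ≡⟨ cong (λ v → 2 * sq x + (2 * sq v ∸ sq d)) y≡x+d ⟨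
  2 * sq x + (2 * sq y ∸ sq d)
    ≡⟨ cong (λ v → (2 * sq x ∸ sq v) + (2 * sq y ∸ sq d)) (m≤n⇒m∸n≡0 x≤y) ⟨
  (2 * sq x ∸ sq (x ∸ y)) + (2 * sq y ∸ sq d)   ∎
  where
  open ≡-Reasoning
  d = y ∸ x
  y≡x+d : y ≡ x + d
  y≡x+d = sym (m+[n∸m]≡n x≤y)
  expand : ∀ x d → (x + (x + d)) * (x + (x + d)) ≡ 2 * (x * x) + (d * d + (2 * (x * x) + 4 * (x * d)))
  expand = solve-∀
  collect : ∀ x d → d * d + (2 * (x * x) + 4 * (x * d)) + d * d ≡ 2 * ((x + d) * (x + d))
  collect = solve-∀

sq-+-charges : ∀ x y → sq (x + y) ≡ (2 * sq x ∸ sq (x ∸ y)) + (2 * sq y ∸ sq (y ∸ x))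
sq-+-charges x y with ≤-total x y
... | inj₁ x≤y = sq-+-ordered x≤y
... | inj₂ y≤x = begin
  sq (x + y)                                            ≡⟨ cong sq (+-comm x y) ⟩
  sq (y + x)                                            ≡⟨ sq-+-ordered y≤x ⟩
  (2 * sq y ∸ sq (y ∸ x)) + (2 * sq x ∸ sq (x ∸ y))     ≡⟨ +-comm (2 * sq y ∸ sq (y ∸ x)) _ ⟩
  (2 * sq x ∸ sq (x ∸ y)) + (2 * sq y ∸ sq (y ∸ x))     ∎
  where open ≡-Reasoning

-- Since `2N - 2a = N - (2a - N)`, the bias of one half fixes the threshold that twice the agreement
-- on the other half must exceed. The result is the quantity squared in the light branch of
-- `charge`.
excess-+-light : ∀ {N} a b → a ≤ N → N ≤ 2 * a → excess (2 * N) (a + b) ≡ 2 * b ∸ (N ∸ excess N a)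
excess-+-light {N} a b a≤N N≤2a = begin
  2 * (a + b) ∸ 2 * N           ≡⟨ cong₂ _∸_ (*-distribˡ-+ 2 a b) 2N≡2a+k ⟩
  (2 * a + 2 * b) ∸ (2 * a + k) ≡⟨ [m+n]∸[m+o]≡n∸o (2 * a) (2 * b) k ⟩
  2 * b ∸ k                     ∎
  where
  open ≡-Reasoning
  x = excess N a
  k = N ∸ x
  x≤N : x ≤ N
  x≤N = m≤n+o⇒m∸n≤o (2 * a) N (≤-trans (*-monoʳ-≤ 2 a≤N) (≤-reflexive (cong (N +_) (+-identityʳ N))))
  regroup : ∀ N x k → N + (x + k) ≡ (N + x) + k
  regroup = solve-∀
  2N≡2a+k : 2 * N ≡ 2 * a + k
  2N≡2a+k = begin
    N + (N + 0)     ≡⟨ cong (N +_) (+-identityʳ N) ⟩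
    N + N           ≡⟨ cong (N +_) (m+[n∸m]≡n x≤N) ⟨
    N + (x + k)     ≡⟨ regroup N x k ⟩
    (N + x) + k     ≡⟨ cong (_+ k) (m+[n∸m]≡n N≤2a) ⟩
    2 * a + k       ∎

-- If both halves are light, the left side is zero. With one heavy half, the charge to that half
-- alone equals the square; with two, `sq-+-charges` splits it exactly.
sq-excess-≤-charges : ∀ {N} a b → a ≤ N → b ≤ N →
  sq (excess (2 * N) (a + b)) ≤ charge N (excess N a) b + charge N (excess N b) a
sq-excess-≤-charges {N} a b a≤N b≤N = cases (≤-<-connex (2 * a) N) (≤-<-connex (2 * b) N)
  where
  open ≤-Reasoning
  x = excess N a
  y = excess N b
  cases : 2 * a ≤ N ⊎ N ℕ.< 2 * a → 2 * b ≤ N ⊎ N ℕ.< 2 * b →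
          sq (excess (2 * N) (a + b)) ≤ charge N x b + charge N y a
  cases (inj₁ a-light) (inj₁ b-light) = begin
    sq (2 * (a + b) ∸ 2 * N)      ≡⟨ cong sq (m≤n⇒m∸n≡0 2[a+b]≤2N) ⟩
    0                             ≤⟨ z≤n ⟩
    charge N x b + charge N y a   ∎
    where
    2[a+b]≤2N : 2 * (a + b) ≤ 2 * N
    2[a+b]≤2N = begin
      2 * (a + b)     ≡⟨ *-distribˡ-+ 2 a b ⟩
      2 * a + 2 * b   ≤⟨ +-mono-≤ a-light b-light ⟩
      N + N           ≡⟨ cong (N +_) (+-identityʳ N) ⟨
      2 * N           ∎
  cases (inj₂ a-heavy) (inj₁ b-light) = begin
    sq (excess (2 * N) (a + b))   ≡⟨ cong sq (excess-+-light a b a≤N (<⇒≤ a-heavy)) ⟩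
    sq (2 * b ∸ (N ∸ x))          ≡⟨ charge-light N x b b-light ⟨
    charge N x b                  ≤⟨ m≤m+n (charge N x b) _ ⟩
    charge N x b + charge N y a   ∎
  cases (inj₁ a-light) (inj₂ b-heavy) = begin
    sq (excess (2 * N) (a + b))   ≡⟨ cong (λ c → sq (excess (2 * N) c)) (+-comm a b) ⟩
    sq (excess (2 * N) (b + a))   ≡⟨ cong sq (excess-+-light b a b≤N (<⇒≤ b-heavy)) ⟩
    sq (2 * a ∸ (N ∸ y))          ≡⟨ charge-light N y a a-light ⟨
    charge N y a                  ≤⟨ m≤n+m (charge N y a) _ ⟩
    charge N x b + charge N y a   ∎
  cases (inj₂ a-heavy) (inj₂ b-heavy) = begin
    sq (excess (2 * N) (a + b))   ≡⟨ cong sq (excess-+ a b (<⇒≤ a-heavy) (<⇒≤ b-heavy)) ⟩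
    sq (x + y)                    ≡⟨ sq-+-charges x y ⟩
    (2 * sq x ∸ sq (x ∸ y)) + (2 * sq y ∸ sq (y ∸ x))
      ≡⟨ cong₂ _+_ (charge-heavy N x b b-heavy) (charge-heavy N y a a-heavy) ⟨
    charge N x b + charge N y a   ∎

-- The function `max(0, t - k)²` is convex and vanishes at `0`, hence is superadditive. This lets
-- several light counts be merged into one.
sq-∸-superadditive : ∀ k x y → sq (x ∸ k) + sq (y ∸ k) ≤ sq ((x + y) ∸ k)
sq-∸-superadditive k x y = begin
  sq (x ∸ k) + sq (y ∸ k)   ≤⟨ m≤m+n _ (2 * ((x ∸ k) * (y ∸ k))) ⟩
  sq (x ∸ k) + sq (y ∸ k) + 2 * ((x ∸ k) * (y ∸ k)) ≡⟨ square (x ∸ k) (y ∸ k) ⟩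
  sq ((x ∸ k) + (y ∸ k))    ≤⟨ sq-mono ∸-superadditive ⟩
  sq ((x + y) ∸ k)          ∎
  where
  open ≤-Reasoning
  square : ∀ p q → p * p + q * q + 2 * (p * q) ≡ (p + q) * (p + q)
  square = solve-∀
  ∸-superadditive : (x ∸ k) + (y ∸ k) ≤ (x + y) ∸ k
  ∸-superadditive with ≤-total x k
  ... | inj₁ x≤k = begin
    (x ∸ k) + (y ∸ k)   ≡⟨ cong (_+ (y ∸ k)) (m≤n⇒m∸n≡0 x≤k) ⟩
    y ∸ k               ≤⟨ ∸-monoˡ-≤ k (m≤n+m y x) ⟩
    (x + y) ∸ k         ∎
  ... | inj₂ k≤x = begin
    (x ∸ k) + (y ∸ k)   ≤⟨ +-monoʳ-≤ (x ∸ k) (m∸n≤m y k) ⟩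
    (x ∸ k) + y         ≡⟨ +-∸-comm y k≤x ⟨
    (x + y) ∸ k         ∎

-- As a function of `2a` on `[0, N]`, the light charge is convex, equal to `0` at `0` and to `B²` at
-- `N`, so it lies below the chord `2a B² / N`. Multiplying by `N` avoids the division.
N*charge-light-≤ : ∀ {N B a} → B ≤ N → 2 * a ≤ N → N * charge N B a ≤ 2 * a * sq B
N*charge-light-≤ {N} {B} {a} B≤N light = begin
  N * charge N B a    ≡⟨ cong (N *_) (charge-light N B a light) ⟩
  N * (e * e)         ≡⟨ *-assoc N e e ⟨
  N * e * e           ≤⟨ *-mono-≤ (N*e≤2a*B (≤-total (2 * a) k)) e≤B ⟩
  2 * a * B * B       ≡⟨ *-assoc (2 * a) B B ⟩
  2 * a * sq B        ∎
  where
  open ≤-Reasoning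
  k = N ∸ B
  e = 2 * a ∸ k
  e≤B : e ≤ B
  e≤B = m≤n+o⇒m∸n≤o (2 * a) k (≤-trans light (≤-reflexive (sym (m∸n+n≡m B≤N))))
  -- The chord estimate is applied to one factor `e` only; the other is bounded by its maximum `B`.
  N*e≤2a*B : 2 * a ≤ k ⊎ k ≤ 2 * a → N * e ≤ 2 * a * B
  N*e≤2a*B (inj₁ 2a≤k) = begin
    N * e       ≡⟨ cong (N *_) (m≤n⇒m∸n≡0 2a≤k) ⟩
    N * 0       ≡⟨ *-zeroʳ N ⟩
    0           ≤⟨ z≤n ⟩
    2 * a * B   ∎
  N*e≤2a*B (inj₂ k≤2a) = begin
    N * e           ≡⟨ cong (_* e) (m∸n+n≡m B≤N) ⟨
    (k + B) * e     ≡⟨ *-distribʳ-+ e k B ⟩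
    k * e + B * e   ≤⟨ +-mono-≤ (*-monoʳ-≤ k e≤B) (≤-reflexive (*-comm B e)) ⟩
    k * B + e * B   ≡⟨ *-distribʳ-+ B k e ⟨
    (k + e) * B     ≡⟨ cong (_* B) (m+[n∸m]≡n k≤2a) ⟩
    2 * a * B       ∎

heavy⇒others-light : ∀ {N} a b → a + b ≤ N → N ℕ.< 2 * a → 2 * b ≤ N
heavy⇒others-light {N} a b a+b≤N heavy = +-cancelˡ-≤ N _ _ (begin
  N + 2 * b       ≤⟨ +-monoˡ-≤ (2 * b) (<⇒≤ heavy) ⟩
  2 * a + 2 * b   ≡⟨ *-distribˡ-+ 2 a b ⟨
  2 * (a + b)     ≤⟨ *-monoʳ-≤ 2 a+b≤N ⟩
  2 * N           ≡⟨ cong (N +_) (+-identityʳ N) ⟩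
  N + N           ∎)
  where open ≤-Reasoning

all-light : ∀ {N} as → 2 * sum as ≤ N → All (λ a → 2 * a ≤ N) as
all-light []       _ = []
all-light (a ∷ as) h = ≤-trans (*-monoʳ-≤ 2 (m≤m+n a (sum as))) h
                     ∷ all-light as (≤-trans (*-monoʳ-≤ 2 (m≤n+m (sum as) a)) h)

module _ {N B : ℕ} (B≤N : B ≤ N) where
  open ≤-Reasoning

  private
    k = N ∸ B

  sum-charge-light : ∀ {as} → All (λ a → 2 * a ≤ N) as →
                     sum (map (charge N B) as) ≤ sq (2 * sum as ∸ k)
  sum-charge-light []                           = z≤n
  sum-charge-light {a ∷ as} (light ∷ lights) = begin
    charge N B a + sum (map (charge N B) as)    ≤⟨ +-mono-≤ (≤-reflexive (charge-light N B a light)) (sum-charge-light lights) ⟩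
    sq (2 * a ∸ k) + sq (2 * sum as ∸ k)        ≤⟨ sq-∸-superadditive k (2 * a) (2 * sum as) ⟩
    sq (2 * a + 2 * sum as ∸ k)                 ≡⟨ cong (λ v → sq (v ∸ k)) (*-distribˡ-+ 2 a (sum as)) ⟨
    sq (2 * (a + sum as) ∸ k)                   ∎

  N*sum-charge-light : ∀ {as} → All (λ a → 2 * a ≤ N) as →
                       N * sum (map (charge N B) as) ≤ 2 * sum as * sq B
  N*sum-charge-light []                       = ≤-reflexive (*-zeroʳ N)
  N*sum-charge-light {a ∷ as} (light ∷ lights) = begin
    N * (charge N B a + sum (map (charge N B) as))      ≡⟨ *-distribˡ-+ N (charge N B a) _ ⟩
    N * charge N B a + N * sum (map (charge N B) as)    ≤⟨ +-mono-≤ (N*charge-light-≤ {a = a} B≤N light) (N*sum-charge-light lights) ⟩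
    2 * a * sq B + 2 * sum as * sq B                    ≡⟨ collect a (sum as) (sq B) ⟩
    2 * (a + sum as) * sq B                             ∎
    where
    collect : ∀ a s q → 2 * a * q + 2 * s * q ≡ 2 * (a + s) * q
    collect = solve-∀

  -- From `a + r ≤ N` follows `2r + x ≤ N`, hence `2r ∸ k ≤ B ∸ x`. The square subtracted in the
  -- heavy charge thus leaves room for the remaining counts, merged into `r`.
  heavy-charge : ∀ a r → a + r ≤ N → N ℕ.< 2 * a → charge N B a + sq (2 * r ∸ k) ≤ 2 * sq B
  heavy-charge a r a+r≤N heavy = begin
    charge N B a + sq (2 * r ∸ k)             ≤⟨ +-mono-≤ (≤-reflexive (charge-heavy N B a heavy)) (sq-mono 2r∸k≤B∸x) ⟩
    2 * sq B ∸ sq (B ∸ x) + sq (B ∸ x)        ≡⟨ m∸n+n≡m sq[B∸x]≤2sqB ⟩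
    2 * sq B                                  ∎
    where
    x = excess N a
    sq[B∸x]≤2sqB : sq (B ∸ x) ≤ 2 * sq B
    sq[B∸x]≤2sqB = ≤-trans (sq-mono (m∸n≤m B x)) (m≤m+n (sq B) _)
    2r+x≤N : 2 * r + x ≤ N
    2r+x≤N = +-cancelʳ-≤ N _ _ (begin
      2 * r + x + N       ≡⟨ +-assoc (2 * r) x N ⟩
      2 * r + (x + N)     ≡⟨ cong (2 * r +_) (m∸n+n≡m (<⇒≤ heavy)) ⟩
      2 * r + 2 * a       ≡⟨ *-distribˡ-+ 2 r a ⟨
      2 * (r + a)         ≡⟨ cong (2 *_) (+-comm r a) ⟩
      2 * (a + r)         ≤⟨ *-monoʳ-≤ 2 a+r≤N ⟩
      2 * N               ≡⟨ cong (N +_) (+-identityʳ N) ⟩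
      N + N               ∎)
    2r∸k≤B∸x : 2 * r ∸ k ≤ B ∸ x
    2r∸k≤B∸x = begin
      2 * r ∸ k           ≤⟨ ∸-monoˡ-≤ k (m+n≤o⇒m≤o∸n (2 * r) 2r+x≤N) ⟩
      N ∸ x ∸ k           ≡⟨ ∸-+-assoc N x k ⟩
      N ∸ (x + k)         ≡⟨ cong (N ∸_) (+-comm x k) ⟩
      N ∸ (k + x)         ≡⟨ ∸-+-assoc N k x ⟨
      N ∸ k ∸ x           ≡⟨ cong (_∸ x) (m∸[m∸n]≡n B≤N) ⟩
      B ∸ x               ∎

  -- The accumulator `r` collects the light counts met before a heavy one, and `sq (2 * r ∸ k)`
  -- dominates their charges. Counts after the heavy one are light, since two counts above `N / 2`
  -- would exceed the total; they join `r` in `heavy-charge`.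
  sum-charge-heavy : ∀ {as} r → r + sum as ≤ N → Any (λ a → N ℕ.< 2 * a) as →
                     sum (map (charge N B) as) + sq (2 * r ∸ k) ≤ 2 * sq B
  sum-charge-heavy {a ∷ as} r r+s≤N (here heavy) = begin
    charge N B a + sum (map (charge N B) as) + sq (2 * r ∸ k)   ≡⟨ +-assoc (charge N B a) _ _ ⟩
    charge N B a + (sum (map (charge N B) as) + sq (2 * r ∸ k)) ≤⟨ +-monoʳ-≤ (charge N B a) others ⟩
    charge N B a + sq (2 * (sum as + r) ∸ k)                    ≤⟨ heavy-charge a (sum as + r) a+others≤N heavy ⟩
    2 * sq B                                                    ∎
    where
    rotate : ∀ r a s → a + (s + r) ≡ r + (a + s)
    rotate = solve-∀
    a+others≤N : a + (sum as + r) ≤ N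
    a+others≤N = ≤-trans (≤-reflexive (rotate r a (sum as))) r+s≤N
    lights : All (λ a → 2 * a ≤ N) as
    lights = all-light as (heavy⇒others-light a (sum as) (≤-trans (+-monoʳ-≤ a (m≤m+n (sum as) r)) a+others≤N) heavy)
    others : sum (map (charge N B) as) + sq (2 * r ∸ k) ≤ sq (2 * (sum as + r) ∸ k)
    others = begin
      sum (map (charge N B) as) + sq (2 * r ∸ k)  ≤⟨ +-monoˡ-≤ _ (sum-charge-light lights) ⟩
      sq (2 * sum as ∸ k) + sq (2 * r ∸ k)        ≤⟨ sq-∸-superadditive k (2 * sum as) (2 * r) ⟩
      sq (2 * sum as + 2 * r ∸ k)                 ≡⟨ cong (λ v → sq (v ∸ k)) (*-distribˡ-+ 2 (sum as) r) ⟨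
      sq (2 * (sum as + r) ∸ k)                   ∎
  sum-charge-heavy {a ∷ as} r r+s≤N (there heavy) with ≤-<-connex (2 * a) N
  ... | inj₂ a-heavy = sum-charge-heavy {a ∷ as} r r+s≤N (here a-heavy)
  ... | inj₁ light   = begin
    charge N B a + S + sq (2 * r ∸ k)           ≡⟨ rotate (charge N B a) S _ ⟩
    S + (sq (2 * r ∸ k) + charge N B a)         ≡⟨ cong (λ v → S + (sq (2 * r ∸ k) + v)) (charge-light N B a light) ⟩
    S + (sq (2 * r ∸ k) + sq (2 * a ∸ k))       ≤⟨ +-monoʳ-≤ S (sq-∸-superadditive k (2 * r) (2 * a)) ⟩
    S + sq (2 * r + 2 * a ∸ k)                  ≡⟨ cong (λ v → S + sq (v ∸ k)) (*-distribˡ-+ 2 r a) ⟨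
    S + sq (2 * (r + a) ∸ k)                    ≤⟨ sum-charge-heavy (r + a) (≤-trans (≤-reflexive (+-assoc r a (sum as))) r+s≤N) heavy ⟩
    2 * sq B                                    ∎
    where
    S = sum (map (charge N B) as)
    rotate : ∀ x y z → x + y + z ≡ y + (z + x)
    rotate = solve-∀

  -- When every count is light, the chord bounds add up to at most `2 (sum as) B² / N`; otherwise
  -- the heavy count leaves room for all others.
  sum-charge-≤ : .{{NonZero N}} → ∀ as → sum as ≤ N → sum (map (charge N B) as) ≤ 2 * sq B
  sum-charge-≤ as s≤N with All.all? (λ a → 2 * a ≤? N) as
  ... | no ¬lights = ≤-trans (m≤m+n _ (sq (2 * 0 ∸ k)))
          (sum-charge-heavy 0 s≤N (Any.map ≰⇒> (¬All⇒Any¬ (λ a → 2 * a ≤? N) as ¬lights)))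
  ... | yes lights = *-cancelˡ-≤ N (begin
    N * sum (map (charge N B) as)   ≤⟨ N*sum-charge-light lights ⟩
    2 * sum as * sq B               ≤⟨ *-monoˡ-≤ (sq B) (*-monoʳ-≤ 2 s≤N) ⟩
    2 * N * sq B                    ≡⟨ rotate N (sq B) ⟩
    N * (2 * sq B)                  ∎)
    where
    rotate : ∀ N q → 2 * N * q ≡ N * (2 * q)
    rotate = solve-∀

-- Finite sums over classes

sum-map-+ : (g h : I → ℕ) (is : List I) →
            sum (map (λ i → g i + h i) is) ≡ sum (map g is) + sum (map h is)
sum-map-+ g h []       = refl
sum-map-+ g h (i ∷ is) = trans (cong (g i + h i +_) (sum-map-+ g h is))
                               (interchange (g i) (h i) _ _)
  where
  interchange : ∀ a b c d → a + b + (c + d) ≡ a + c + (b + d)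
  interchange = solve-∀

sum-map-≤ : {g h : I → ℕ} {is : List I} → All (λ i → g i ≤ h i) is →
            sum (map g is) ≤ sum (map h is)
sum-map-≤ []       = z≤n
sum-map-≤ (p ∷ ps) = +-mono-≤ p (sum-map-≤ ps)

sum-map-* : ∀ k (g : I → ℕ) is → sum (map (λ i → k * g i) is) ≡ k * sum (map g is)
sum-map-* k g []       = sym (*-zeroʳ k)
sum-map-* k g (i ∷ is) = trans (cong (k * g i +_) (sum-map-* k g is)) (sym (*-distribˡ-+ k (g i) _))

module _ {I : Set ℓ₁} {R : Rel I ℓ₂} (R? : Decidable R) where

  representatives : Reflexive R → Symmetric R → (is : List I) →
    Σ (List I) λ rs → AllPairs (λ r s → ¬ R r s) rs × All (λ i → Any (λ r → R r i) rs) is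
  representatives rfl symm []       = [] , [] , []
  representatives rfl symm (i ∷ is) with representatives rfl symm is
  ... | rs , distinct , covered with Any.any? (λ r → R? r i) rs
  ...   | yes i-covered = rs , distinct , i-covered ∷ covered
  ...   | no  i-new     = i ∷ rs
                        , All.map (λ ¬Rri Rir → ¬Rri (symm Rir)) (¬Any⇒All¬ rs i-new) ∷ distinct
                        , here rfl ∷ All.map there covered

  -- Every index is counted in at least one class, and overlaps only enlarge the right side.
  sum-over-classes : (g : I → ℕ) {is rs : List I} → All (λ i → Any (λ r → R r i) rs) is →
    sum (map g is) ≤ sum (map (λ r → sum (map g (filter (R? r) is))) rs)
  sum-over-classes g []                        = z≤n
  sum-over-classes g {i ∷ is} {rs} (cov ∷ covered) = begin
    g i + sum (map g is)                    ≤⟨ +-monoʳ-≤ (g i) (sum-over-classes g covered) ⟩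
    g i + sum (map (class is) rs)           ≤⟨ insert cov ⟩
    sum (map (class (i ∷ is)) rs)           ∎
    where
    open ≤-Reasoning
    class : List I → I → ℕ
    class js r = sum (map g (filter (R? r) js))
    class-grows : ∀ r → class is r ≤ class (i ∷ is) r
    class-grows r with R? r i
    ... | yes _ = m≤n+m _ (g i)
    ... | no  _ = ≤-refl
    class-hit : ∀ {r} → R r i → g i + class is r ≤ class (i ∷ is) r
    class-hit {r} Rri with R? r i
    ... | yes _   = ≤-refl
    ... | no ¬Rri = contradiction Rri ¬Rri
    -- The new term is absorbed by the representative that the coverage proof points to; the other
    -- class sums can only grow.
    insert : ∀ {ss} → Any (λ r → R r i) ss →
             g i + sum (map (class is) ss) ≤ sum (map (class (i ∷ is)) ss)
    insert {r ∷ ss} (here Rri) = begin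
      g i + (class is r + sum (map (class is) ss))  ≡⟨ +-assoc (g i) _ _ ⟨
      g i + class is r + sum (map (class is) ss)
        ≤⟨ +-mono-≤ (class-hit Rri) (sum-map-≤ (All.universal class-grows ss)) ⟩
      sum (map (class (i ∷ is)) (r ∷ ss))           ∎
    insert {r ∷ ss} (there hit) = begin
      g i + (class is r + sum (map (class is) ss))  ≡⟨ swap (g i) (class is r) _ ⟩
      class is r + (g i + sum (map (class is) ss))  ≤⟨ +-mono-≤ (class-grows r) (insert hit) ⟩
      sum (map (class (i ∷ is)) (r ∷ ss))           ∎
      where
      swap : ∀ a b c → a + (b + c) ≡ b + (a + c)
      swap = solve-∀

-- Subsets of the cube

-- Recursion over the two halves makes the splitting of a cardinality definitional; `count≡card`
-- links it to the list-based `count`.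
card : ∀ n → (Cube n → Bool) → ℕ
card zero    A = if A [] then 1 else 0
card (suc n) A = card n (A ∘ (false ∷_)) + card n (A ∘ (true ∷_))

card-≤ : ∀ n A → card n A ≤ 2 ^ n
card-≤ zero    A with A []
... | true  = ≤-refl
... | false = z≤n
card-≤ (suc n) A = ≤-trans (+-mono-≤ (card-≤ n _) (card-≤ n _)) (≤-reflexive (sym (2*m≡m+m (2 ^ n))))

card-mono : ∀ n {A B : Cube n → Bool} → (∀ x → T (A x) → T (B x)) → card n A ≤ card n B
card-mono zero    {A} {B} A⊆B with A [] | B [] | A⊆B []
... | false | _     | _ = z≤n
... | true  | true  | _ = ≤-refl
... | true  | false | h = contradiction (h _) (λ ())
card-mono (suc n) A⊆B = +-mono-≤ (card-mono n (A⊆B ∘ (false ∷_))) (card-mono n (A⊆B ∘ (true ∷_)))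

sum-card-disjoint : ∀ n (A : I → Cube n → Bool) {is} →
  AllPairs (λ i j → ∀ x → T (A i x) → ¬ T (A j x)) is →
  sum (map (λ i → card n (A i)) is) ≤ 2 ^ n
sum-card-disjoint zero A []                     = z≤n
sum-card-disjoint zero A {i ∷ is} (disj ∷ disjs) with A i [] | All.map (λ h → h []) disj
... | false | _     = sum-card-disjoint zero A disjs
-- The point lies in the set of `i`, so all later sets are empty and the sum is `1 + 0`.
... | true  | empty = s≤s (≤-reflexive (none empty))
  where
  none : ∀ {js} → All (λ j → _ → ¬ T (A j [])) js → sum (map (λ j → card zero (A j)) js) ≡ 0
  none []                  = refl
  none {j ∷ js} (¬Aj ∷ ¬As) with A j [] | ¬Aj _
  ... | false | _  = none ¬As
  ... | true  | ¬t = contradiction _ ¬t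
sum-card-disjoint (suc n) A {is} disj = begin
  sum (map (λ i → card n (A i ∘ (false ∷_)) + card n (A i ∘ (true ∷_))) is)
    ≡⟨ sum-map-+ _ _ is ⟩
  sum (map (λ i → card n (A i ∘ (false ∷_))) is) + sum (map (λ i → card n (A i ∘ (true ∷_))) is)
    ≤⟨ +-mono-≤ (half false) (half true) ⟩
  2 ^ n + 2 ^ n
    ≡⟨ 2*m≡m+m (2 ^ n) ⟨
  2 ^ suc n ∎
  where
  open ≤-Reasoning
  half : ∀ b → sum (map (λ i → card n (A i ∘ (b ∷_))) is) ≤ 2 ^ n
  half b = sum-card-disjoint n (λ i → A i ∘ (b ∷_)) (AllPairs.map (λ h x → h (b ∷ x)) disj)

length-filter-map : ∀ {A B : Set} (S : B → Bool) (g : A → B) xs →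
  length (filter (T? ∘ S) (map g xs)) ≡ length (filter (T? ∘ S ∘ g) xs)
length-filter-map S g []       = refl
length-filter-map S g (x ∷ xs) with S (g x)
... | true  = cong suc (length-filter-map S g xs)
... | false = length-filter-map S g xs

count≡card : ∀ n S → count n S ≡ card n S
count≡card zero    S with S []
... | true  = refl
... | false = refl
count≡card (suc n) S = begin
  length (filter (T? ∘ S) (map (false ∷_) xs ++ map (true ∷_) xs))
    ≡⟨ cong length (filter-++ (T? ∘ S) (map (false ∷_) xs) _) ⟩
  length (filter (T? ∘ S) (map (false ∷_) xs) ++ filter (T? ∘ S) (map (true ∷_) xs))
    ≡⟨ length-++ (filter (T? ∘ S) (map (false ∷_) xs)) ⟩
  length (filter (T? ∘ S) (map (false ∷_) xs)) + length (filter (T? ∘ S) (map (true ∷_) xs))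
    ≡⟨ cong₂ _+_ (half-count false) (half-count true) ⟩
  card n (S ∘ (false ∷_)) + card n (S ∘ (true ∷_)) ∎
  where
  open ≡-Reasoning
  xs = allPoints n
  half-count : ∀ b → length (filter (T? ∘ S) (map (b ∷_) xs)) ≡ card n (S ∘ (b ∷_))
  half-count b = trans (length-filter-map S (b ∷_) xs) (count≡card n (S ∘ (b ∷_)))

card-cover : ∀ n {A B : Cube n → Bool} → (∀ x → A x ≡ false → T (B x)) → 2 ^ n ≤ card n A + card n B
card-cover zero    {A} {B} cover with A [] | B [] | cover []
... | true  | _     | _ = s≤s z≤n
... | false | true  | _ = ≤-refl
... | false | false | h = contradiction (h refl) (λ ())
card-cover (suc n) {A} {B} cover = begin
  2 ^ suc n                                       ≡⟨ 2*m≡m+m (2 ^ n) ⟩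
  2 ^ n + 2 ^ n                                   ≤⟨ +-mono-≤ (card-cover n (cover ∘ (false ∷_))) (card-cover n (cover ∘ (true ∷_))) ⟩
  (card n _ + card n _) + (card n _ + card n _)   ≡⟨ interchange (card n (A ∘ (false ∷_))) (card n (B ∘ (false ∷_))) _ _ ⟩
  card (suc n) A + card (suc n) B                 ∎
  where
  open ≤-Reasoning
  interchange : ∀ a b c d → a + b + (c + d) ≡ a + c + (b + d)
  interchange = solve-∀

-- Decisions and double negations over finite sets

all-cube? : ∀ n {P : Cube n → Set ℓ₁} → (∀ x → Dec (P x)) → Dec (∀ x → P x)
all-cube? zero    P? = map′ (λ { p [] → p }) (λ h → h []) (P? [])
all-cube? (suc n) P? = map′ (λ { (p , q) (false ∷ x) → p x ; (p , q) (true ∷ x) → q x })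
                            (λ h → h ∘ (false ∷_) , h ∘ (true ∷_))
                            (all-cube? n (P? ∘ (false ∷_)) ×-dec all-cube? n (P? ∘ (true ∷_)))

-- Finiteness makes this double-negation shift constructive: witnesses are collected one index at a
-- time. It serves to assume decisions of equality in `G`.
¬¬-Fin : ∀ {n} {P : Fin n → Set ℓ₁} → (∀ i → ¬ ¬ P i) → ¬ ¬ (∀ i → P i)
¬¬-Fin {n = zero}  ¬¬P k = k λ ()
¬¬-Fin {n = suc n} ¬¬P k = ¬¬P zero λ p → ¬¬-Fin (¬¬P ∘ suc) λ ps → k λ { zero → p ; (suc i) → ps i }

¬¬-Cube : ∀ n {P : Cube n → Set ℓ₁} → (∀ x → ¬ ¬ P x) → ¬ ¬ (∀ x → P x)
¬¬-Cube zero    ¬¬P k = ¬¬P [] λ p → k λ { [] → p }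
¬¬-Cube (suc n) ¬¬P k = ¬¬-Cube n (¬¬P ∘ (false ∷_)) λ p → ¬¬-Cube n (¬¬P ∘ (true ∷_)) λ q →
  k λ { (false ∷ x) → p x ; (true ∷ x) → q x }

-- Rational estimates

-- The normalisation in `_/_` is stuck on a variable `k`; the explicit fraction lets rational
-- operations compute.
toℚ≡ : ∀ k → toℚ k ≡ mkℚ (ℤ.+ k) 0 (Coprime.sym (Coprime.1-coprimeTo k))
toℚ≡ k = ℚ.normalize-coprime (Coprime.sym (Coprime.1-coprimeTo k))

toℚ-+ : ∀ m n → toℚ (m + n) ≡ toℚ m ℚ.+ toℚ n
toℚ-+ m n rewrite toℚ≡ m | toℚ≡ n =
  cong (ℚ._/ 1) (sym (cong₂ ℤ._+_ (ℤ.*-identityʳ (ℤ.+ m)) (ℤ.*-identityʳ (ℤ.+ n))))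

toℚ-* : ∀ m n → toℚ (m * n) ≡ toℚ m ℚ.* toℚ n
toℚ-* m n rewrite toℚ≡ m | toℚ≡ n = cong (ℚ._/ 1) (ℤ.pos-* m n)

toℚ-mono : ∀ {m n} → m ≤ n → toℚ m ℚ.≤ toℚ n
toℚ-mono {m} {n} m≤n rewrite toℚ≡ m | toℚ≡ n = ℚ.*≤* (ℤ.*-monoʳ-≤-nonNeg (ℤ.+ 1) (ℤ.+≤+ m≤n))

toℚ-nonNeg : ∀ n → NonNegative (toℚ n)
toℚ-nonNeg n rewrite toℚ≡ n = _

toℚ-pos : ∀ n → .{{NonZero n}} → Positive (toℚ n)
toℚ-pos (suc n) rewrite toℚ≡ (suc n) = _

ℚ-sq-mono : ∀ {p q} → .{{NonNegative p}} → p ℚ.≤ q → p ℚ.* p ℚ.≤ q ℚ.* q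
ℚ-sq-mono {p} {q} p≤q = ℚ.≤-trans (ℚ.*-monoˡ-≤-nonNeg p p≤q)
  (ℚ.*-monoʳ-≤-nonNeg q {{ℚ.nonNegative (ℚ.≤-trans (ℚ.nonNegative⁻¹ p) p≤q)}} p≤q)

length*≤sum : ∀ {I : Set} (g : I → ℕ) q {is} → All (λ i → q ℚ.≤ toℚ (g i)) is →
              toℚ (length is) ℚ.* q ℚ.≤ toℚ (sum (map g is))
length*≤sum g q []                 = ℚ.≤-reflexive (ℚ.*-zeroˡ q)
length*≤sum g q {i ∷ is} (le ∷ les) = begin
  toℚ (suc (length is)) ℚ.* q             ≡⟨ cong (ℚ._* q) (toℚ-+ 1 (length is)) ⟩
  (1ℚ ℚ.+ toℚ (length is)) ℚ.* q          ≡⟨ ℚ.*-distribʳ-+ q 1ℚ (toℚ (length is)) ⟩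
  1ℚ ℚ.* q ℚ.+ toℚ (length is) ℚ.* q      ≡⟨ cong (ℚ._+ toℚ (length is) ℚ.* q) (ℚ.*-identityˡ q) ⟩
  q ℚ.+ toℚ (length is) ℚ.* q             ≤⟨ ℚ.+-mono-≤ le (length*≤sum g q les) ⟩
  toℚ (g i) ℚ.+ toℚ (sum (map g is))      ≡⟨ toℚ-+ (g i) _ ⟨
  toℚ (sum (map g (i ∷ is)))              ∎
  where open ℚ.≤-Reasoning

¼ : ℚ
¼ = ℤ.+ 1 ℚ./ 4

module _ (ε : ℚ) .{{ε>0 : Positive ε}} where
  open ℚ.≤-Reasoning

  -- From `N ≤ s + a` comes `2a - N ≥ N - 2s`, and the bound on `s` makes the right side at least
  -- `2εN`.
  close⇒biased : ∀ N s a → N ≤ s + a → toℚ s ℚ.≤ (½ - ε) ℚ.* toℚ N →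
                 (ε ℚ.+ ε) ℚ.* toℚ N ℚ.≤ toℚ (excess N a)
  close⇒biased N s a N≤s+a close = begin
    (ε ℚ.+ ε) ℚ.* M                           ≡⟨ rearrange₁ ε M ⟩
    M ℚ.+ c                                   ≤⟨ ℚ.+-monoˡ-≤ c (toℚ-mono N≤2s+t) ⟩
    toℚ (s + s + t) ℚ.+ c                     ≡⟨ cong (ℚ._+ c) (trans (toℚ-+ (s + s) t) (cong (ℚ._+ toℚ t) (toℚ-+ s s))) ⟩
    toℚ s ℚ.+ toℚ s ℚ.+ toℚ t ℚ.+ c           ≤⟨ ℚ.+-monoˡ-≤ c (ℚ.+-monoˡ-≤ (toℚ t) (ℚ.+-mono-≤ close close)) ⟩
    (½ - ε) ℚ.* M ℚ.+ (½ - ε) ℚ.* M ℚ.+ toℚ t ℚ.+ c  ≡⟨ rearrange₂ ε M (toℚ t) ⟩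
    toℚ t                                     ∎
    where
    t = excess N a
    M = toℚ N
    -- Adding `c = -(1 - 2ε)N` turns `N` into `2εN` and cancels the upper bound on `2s`.
    c = ℚ.- ((½ - ε) ℚ.* M ℚ.+ (½ - ε) ℚ.* M)
    N≤2s+t : N ≤ s + s + t
    N≤2s+t = +-cancelˡ-≤ N _ _ (≤-trans (+-mono-≤ N≤s+a N≤s+a) (≤-trans (≤-reflexive (gather s a))
               (≤-trans (+-monoʳ-≤ (s + s) (m≤n+m∸n (2 * a) N)) (≤-reflexive (swap N (s + s) t)))))
      where
      gather : ∀ s a → s + a + (s + a) ≡ s + s + 2 * a
      gather = solve-∀
      swap : ∀ N s t → s + (N + t) ≡ N + (s + t)
      swap = solve-∀
    open +-*-Solver
    rearrange₁ : ∀ ε M → (ε ℚ.+ ε) ℚ.* M ≡ M ℚ.+ ℚ.- ((½ - ε) ℚ.* M ℚ.+ (½ - ε) ℚ.* M)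
    rearrange₁ = solve 2 (λ e m → (e :+ e) :* m := m :+ :- ((con ½ :- e) :* m :+ (con ½ :- e) :* m)) refl
    rearrange₂ : ∀ ε M t → (½ - ε) ℚ.* M ℚ.+ (½ - ε) ℚ.* M ℚ.+ t ℚ.+ ℚ.- ((½ - ε) ℚ.* M ℚ.+ (½ - ε) ℚ.* M) ≡ t
    rearrange₂ = solve 3 (λ e m t → (con ½ :- e) :* m :+ (con ½ :- e) :* m :+ t :+ :- ((con ½ :- e) :* m :+ (con ½ :- e) :* m) := t) refl

  -- The coefficients, constant term first, are those of `x²/4`. The bound `1/(4ε²)` results from
  -- cancelling `k = 4ε²N²` in `L · 4ε²N² ≤ N²`.
  length-bound : ∀ L N → .{{NonZero N}} →
    toℚ L ℚ.* (((ε ℚ.+ ε) ℚ.* toℚ N) ℚ.* ((ε ℚ.+ ε) ℚ.* toℚ N)) ℚ.≤ toℚ (sq N) →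
    toℚ L ℚ.≤ evalPoly (0ℚ ∷ 0ℚ ∷ ¼ ∷ []) ((1/ ε) {{pos⇒nonZero ε}})
  length-bound L N h = ℚ.*-cancelʳ-≤-pos k {{k>0}} (begin
    toℚ L ℚ.* k                       ≡⟨ cong (toℚ L ℚ.*_) (regroup ε M) ⟨
    toℚ L ℚ.* (((ε ℚ.+ ε) ℚ.* M) ℚ.* ((ε ℚ.+ ε) ℚ.* M)) ≤⟨ h ⟩
    toℚ (sq N)                        ≡⟨ toℚ-* N N ⟩
    M ℚ.* M                           ≡⟨ unit M ⟨
    -- Replacing each `1` by `ε · e⁻¹` makes `N²` a multiple of `k`; the solver can then treat `e⁻¹`
    -- as an independent variable.
    1ℚ ℚ.* 1ℚ ℚ.* (M ℚ.* M)           ≡⟨ cong (λ u → u ℚ.* u ℚ.* (M ℚ.* M)) (ℚ.*-inverseʳ ε) ⟨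
    (ε ℚ.* e⁻¹) ℚ.* (ε ℚ.* e⁻¹) ℚ.* (M ℚ.* M) ≡⟨ expand ε e⁻¹ M ⟩
    evalPoly (0ℚ ∷ 0ℚ ∷ ¼ ∷ []) e⁻¹ ℚ.* k ∎)
    where
    instance _ = pos⇒nonZero ε
    M = toℚ N
    e⁻¹ = 1/ ε
    k = toℚ 4 ℚ.* ((ε ℚ.* ε) ℚ.* (M ℚ.* M))
    k>0 : Positive k
    k>0 = ℚ.pos*pos⇒pos (toℚ 4) ((ε ℚ.* ε) ℚ.* (M ℚ.* M))
            {{ℚ.pos*pos⇒pos (ε ℚ.* ε) {{ℚ.pos*pos⇒pos ε ε}} (M ℚ.* M) {{ℚ.pos*pos⇒pos M {{toℚ-pos N}} M {{toℚ-pos N}}}}}}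
    open +-*-Solver
    regroup : ∀ e m → ((e ℚ.+ e) ℚ.* m) ℚ.* ((e ℚ.+ e) ℚ.* m) ≡ toℚ 4 ℚ.* ((e ℚ.* e) ℚ.* (m ℚ.* m))
    regroup = solve 2 (λ e m → ((e :+ e) :* m) :* ((e :+ e) :* m) := con (toℚ 4) :* ((e :* e) :* (m :* m))) refl
    unit : ∀ m → 1ℚ ℚ.* 1ℚ ℚ.* (m ℚ.* m) ≡ m ℚ.* m
    unit = solve 1 (λ m → con 1ℚ :* con 1ℚ :* (m :* m) := m :* m) refl
    expand : ∀ e i m → (e ℚ.* i) ℚ.* (e ℚ.* i) ℚ.* (m ℚ.* m) ≡
             evalPoly (0ℚ ∷ 0ℚ ∷ ¼ ∷ []) i ℚ.* (toℚ 4 ℚ.* ((e ℚ.* e) ℚ.* (m ℚ.* m)))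
    expand = solve 3 (λ e i m → (e :* i) :* (e :* i) :* (m :* m) :=
      (con 0ℚ :+ i :* (con 0ℚ :+ i :* (con ¼ :+ i :* con 0ℚ))) :* (con (toℚ 4) :* ((e :* e) :* (m :* m)))) refl

-- Affine functions

module _ {c ℓ : Level} (G : AbelianGroup c ℓ) where
  open AbelianGroup G renaming (Carrier to C; ε to 0#) hiding (refl; sym; trans; _-_)
  open AbelianGroup G using () renaming (refl to ≈-refl; sym to ≈-sym; trans to ≈-trans)
  open import Algebra.Properties.Group group using (∙-cancelˡ; ∙-cancelʳ)

  infix 4 _≐_
  _≐_ : ∀ {n} → (Cube n → C) → (Cube n → C) → Set ℓ
  F ≐ H = ∀ x → F x ≈ H x

  -- This coefficient-free form passes directly to halves; the constant `a` plays the role of the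
  -- coefficient of the first variable.
  IsAffine : ∀ n → (Cube n → C) → Set (c ⊔ ℓ)
  IsAffine zero    F = ⊤
  IsAffine (suc n) F = (∀ b → IsAffine n (F ∘ (b ∷_)))
                     × Σ C λ a → ∀ x → F (true ∷ x) ≈ F (false ∷ x) ∙ a

  -- Above the common point `x` both halves agree, so cancellation identifies the increments `a` and
  -- `a′`, and the known half then determines the other. This is the source of the disjointness
  -- behind the class bound.
  opposite-half : ∀ {n} {F H : Cube (suc n) → C} → IsAffine (suc n) F → IsAffine (suc n) H → ∀ b →
    F ∘ (b ∷_) ≐ H ∘ (b ∷_) → ∀ x → F (not b ∷ x) ≈ H (not b ∷ x) → F ≐ H
  opposite-half {n} {F} {H} (_ , a , Fa) (_ , a′ , Ha′) = λ where
      false same x hit (false ∷ y) → same y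
      false same x hit (true  ∷ y) → ≈-trans (Fa y) (≈-trans (∙-cong (same y) (a≈a′ x (same x) hit)) (≈-sym (Ha′ y)))
      true  same x hit (true  ∷ y) → same y
      true  same x hit (false ∷ y) → ∙-cancelʳ a _ _ (≈-trans (≈-sym (Fa y)) (≈-trans (same y)
                                       (≈-trans (Ha′ y) (∙-congˡ (≈-sym (a≈a′ x hit (same x)))))))
    where
    a≈a′ : ∀ x → F (false ∷ x) ≈ H (false ∷ x) → F (true ∷ x) ≈ H (true ∷ x) → a ≈ a′
    a≈a′ x eq₀ eq₁ = ∙-cancelˡ (F (false ∷ x)) a a′
      (≈-trans (≈-sym (Fa x)) (≈-trans eq₁ (≈-trans (Ha′ x) (∙-congʳ (≈-sym eq₀)))))

  -- Restriction to a half keeps the index type, so a function and its restrictions share an index.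
  -- Different indices may then name equal functions, which is why distinctness is imposed on lists
  -- of indices.
  record Family (n : ℕ) (I : Set ℓ₁) : Set (c ⊔ ℓ ⊔ ℓ₁) where
    field
      target   : Cube n → C
      member   : I → Cube n → C
      affine   : ∀ i → IsAffine n (member i)
      hits?    : ∀ i x → Dec (target x ≈ member i x)
      meets?   : ∀ i j x → Dec (member i x ≈ member j x)

    agreement : I → ℕ
    agreement i = card n (λ x → ⌊ hits? i x ⌋)

    bias : I → ℕ
    bias i = excess (2 ^ n) (agreement i)

    Distinct : List I → Set (ℓ ⊔ ℓ₁)
    Distinct = AllPairs (λ i j → ¬ (member i ≐ member j))

    same? : Decidable (λ i j → member i ≐ member j)
    same? i j = all-cube? n (meets? i j)

    agreement-mono : ∀ {i j} → member i ≐ member j → agreement i ≤ agreement j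
    agreement-mono i≐j = card-mono n λ x hit → fromWitness (≈-trans (toWitness hit) (i≐j x))

    agreement-cong : ∀ {i j} → member i ≐ member j → agreement i ≡ agreement j
    agreement-cong i≐j = ≤-antisym (agreement-mono i≐j) (agreement-mono (≈-sym ∘ i≐j))

  open Family

  half : ∀ {n} {I : Set ℓ₁} → Bool → Family (suc n) I → Family n I
  half b 𝓕 = record
    { target = target 𝓕 ∘ (b ∷_)
    ; member = λ i → member 𝓕 i ∘ (b ∷_)
    ; affine = λ i → proj₁ (affine 𝓕 i) b
    ; hits?  = λ i → hits? 𝓕 i ∘ (b ∷_)
    ; meets? = λ i j → meets? 𝓕 i j ∘ (b ∷_)
    }

  SqBiasBound : ∀ {n} {I : Set ℓ₁} → Family n I → Set (ℓ ⊔ ℓ₁)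
  SqBiasBound {n = n} 𝓕 = ∀ is → Distinct 𝓕 is → sum (map (λ i → sq (bias 𝓕 i)) is) ≤ sq (2 ^ n)

  module _ {n} {I : Set ℓ₁} (𝓕 : Family (suc n) I) (b : Bool) where
    open ≤-Reasoning
    private
      near = half b 𝓕
      far  = half (not b) 𝓕
      N    = 2 ^ n
      near-charge : I → ℕ
      near-charge i = charge N (bias near i) (agreement far i)

    -- The half `near` receives the charge. Two members with the same `near` restriction that both
    -- hit the target at one point of `far` coincide by `opposite-half`, so the agreement sets on
    -- `far` are disjoint.
    sum-agreement-far : ∀ {r is} → Distinct 𝓕 is → All (λ i → member near r ≐ member near i) is →
                        sum (map (agreement far) is) ≤ N
    sum-agreement-far {r} {is} distinct same = sum-card-disjoint n (λ i x → ⌊ hits? far i x ⌋) (disjoint distinct same)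
      where
      disjoint : ∀ {js} → Distinct 𝓕 js → All (λ i → member near r ≐ member near i) js →
                 AllPairs (λ i j → ∀ x → T ⌊ hits? far i x ⌋ → ¬ T ⌊ hits? far j x ⌋) js
      disjoint []           []           = []
      disjoint (i≢ ∷ dist) (r≐i ∷ r≐js) =
        All.zipWith (λ (i≢j , r≐j) x hitᵢ hitⱼ → i≢j
          (opposite-half (affine 𝓕 _) (affine 𝓕 _) b (λ y → ≈-trans (≈-sym (r≐i y)) (r≐j y)) x
            (≈-trans (≈-sym (toWitness hitᵢ)) (toWitness hitⱼ)))) (i≢ , r≐js)
        ∷ disjoint dist r≐js

    -- All members of a class share the bias of `r`, so their charges depend only on the agreement
    -- counts on `far`, and `sum-charge-≤` applies.
    class-charge-≤ : ∀ {r is} → Distinct 𝓕 is → All (λ i → member near r ≐ member near i) is →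
                     sum (map near-charge is) ≤ 2 * sq (bias near r)
    class-charge-≤ {r} {is} distinct same = begin
      sum (map near-charge is)                              ≡⟨ cong sum (relabel same) ⟩
      sum (map (charge N (bias near r)) (map (agreement far) is))
        ≤⟨ sum-charge-≤ bias≤N {{m^n≢0 2 n}} (map (agreement far) is) (sum-agreement-far distinct same) ⟩
      2 * sq (bias near r)                                  ∎
      where
      bias≤N : bias near r ≤ N
      bias≤N = m≤n+o⇒m∸n≤o _ N (≤-trans (*-monoʳ-≤ 2 (card-≤ n _)) (≤-reflexive (2*m≡m+m N)))
      relabel : ∀ {js} → All (λ i → member near r ≐ member near i) js →
                map near-charge js ≡ map (charge N (bias near r)) (map (agreement far) js)
      relabel []                    = refl
      relabel {j ∷ _} (r≐j ∷ r≐js) = cong₂ _∷_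
        (cong (λ a → charge N (excess N a) (agreement far j)) (sym (agreement-cong near r≐j)))
        (relabel r≐js)

    -- Members are grouped by their `near` restriction. Each class costs at most twice the squared
    -- bias of its representative, and the representatives are pairwise distinct, so the bound for
    -- `near` applies to them.
    sum-charge-half : SqBiasBound near → ∀ {is} → Distinct 𝓕 is → sum (map near-charge is) ≤ 2 * sq N
    sum-charge-half ih {is} distinct with representatives (same? near) (λ _ → ≈-refl) (λ i≐j x → ≈-sym (i≐j x)) is
    ... | rs , rs-distinct , covered = begin
      sum (map near-charge is)
        ≤⟨ sum-over-classes (same? near) near-charge covered ⟩
      sum (map (λ r → sum (map near-charge (filter (same? near r) is))) rs)
        ≤⟨ sum-map-≤ (All.universal (λ r → class-charge-≤ (AllPairsₚ.filter⁺ (same? near r) distinct)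
                                                          (all-filter (same? near r) is)) rs) ⟩
      sum (map (λ r → 2 * sq (bias near r)) rs)
        ≡⟨ sum-map-* 2 (λ r → sq (bias near r)) rs ⟩
      2 * sum (map (λ r → sq (bias near r)) rs)
        ≤⟨ *-monoʳ-≤ 2 (ih rs rs-distinct) ⟩
      2 * sq N ∎

  -- On a single point, distinct functions have distinct values, so at most one hits the target. In
  -- the inductive step each half receives at most `2N²`, and `2N² + 2N² = (2N)²`.
  sqBiasBound : ∀ n {I : Set ℓ₁} (𝓕 : Family n I) → SqBiasBound 𝓕
  sqBiasBound zero 𝓕 is distinct = begin
    sum (map (λ i → sq (bias 𝓕 i)) is)    ≤⟨ sum-map-≤ (All.universal (λ i → sq-excess₁ (card-≤ 0 (λ x → ⌊ hits? 𝓕 i x ⌋))) is) ⟩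
    sum (map (agreement 𝓕) is)            ≤⟨ sum-card-disjoint 0 (λ i x → ⌊ hits? 𝓕 i x ⌋) (AllPairs.map disjoint distinct) ⟩
    1                                     ∎
    where
    open ≤-Reasoning
    sq-excess₁ : ∀ {a} → a ≤ 1 → sq (excess 1 a) ≤ a
    sq-excess₁ z≤n       = z≤n
    sq-excess₁ (s≤s z≤n) = ≤-refl
    disjoint : ∀ {i j} → ¬ (member 𝓕 i ≐ member 𝓕 j) → ∀ x → T ⌊ hits? 𝓕 i x ⌋ → ¬ T ⌊ hits? 𝓕 j x ⌋
    disjoint i≢j [] hitᵢ hitⱼ = i≢j λ { [] → ≈-trans (≈-sym (toWitness hitᵢ)) (toWitness hitⱼ) }
  sqBiasBound (suc n) 𝓕 is distinct = begin
    sum (map (λ i → sq (bias 𝓕 i)) is)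
      ≤⟨ sum-map-≤ (All.universal (λ i → sq-excess-≤-charges (agreement 𝓕₀ i) (agreement 𝓕₁ i) (card-≤ n _) (card-≤ n _)) is) ⟩
    sum (map (λ i → charge N (bias 𝓕₀ i) (agreement 𝓕₁ i) + charge N (bias 𝓕₁ i) (agreement 𝓕₀ i)) is)
      ≡⟨ sum-map-+ _ _ is ⟩
    sum (map (λ i → charge N (bias 𝓕₀ i) (agreement 𝓕₁ i)) is) + sum (map (λ i → charge N (bias 𝓕₁ i) (agreement 𝓕₀ i)) is)
      ≤⟨ +-mono-≤ (sum-charge-half 𝓕 false (sqBiasBound n 𝓕₀) distinct) (sum-charge-half 𝓕 true (sqBiasBound n 𝓕₁) distinct) ⟩
    2 * sq N + 2 * sq N
      ≡⟨ collect N ⟩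
    sq (2 * N) ∎
    where
    open ≤-Reasoning
    N  = 2 ^ n
    𝓕₀ = half false 𝓕
    𝓕₁ = half true 𝓕
    collect : ∀ N → 2 * (N * N) + 2 * (N * N) ≡ (2 * N) * (2 * N)
    collect = solve-∀

  -- Generalising over the translation-like map `h` carries the induction: fixing the first
  -- coordinate adds a constant, which is absorbed into `h`.
  linSum-affine : ∀ {n} (as : Vec C n) (h : C → C) →
    (∀ {u v} → u ≈ v → h u ≈ h v) → (∀ u v → h (u ∙ v) ≈ h u ∙ v) → IsAffine n (h ∘ linSum G as)
  linSum-affine []       h h-cong h-shift = tt
  linSum-affine (a ∷ as) h h-cong h-shift
    = (λ b → linSum-affine as (λ u → h ((if b then a else 0#) ∙ u)) (h-cong ∘ ∙-congˡ)
               (λ u v → ≈-trans (h-cong (≈-sym (assoc _ u v))) (h-shift _ v)))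
    -- Commutativity moves `a` to the right, and the unit restores the summand `0#` of the false
    -- half.
    , a , λ x → ≈-trans (h-cong (≈-trans (comm a _) (∙-congʳ (≈-sym (identityˡ _))))) (h-shift _ a)

  evalLin-affine : ∀ {n} (P : Lin G n) → IsAffine n (evalLin G P)
  evalLin-affine (a₀ , as) = linSum-affine as (a₀ ∙_) ∙-congˡ (λ u v → ≈-sym (assoc a₀ u v))

  -- The bound is a decidable proposition, so the finitely many equalities in G that the
  -- counting argument inspects may be assumed decided.
  list-bound : ∀ (ε : ℚ) .{{_ : Positive ε}} n (f : Cube n → C) →
    AtMostCloseTo G n f (½ - ε) (evalPoly (0ℚ ∷ 0ℚ ∷ ¼ ∷ []) ((1/ ε) {{pos⇒nonZero ε}}))
  list-bound ε n f Ps distinct close = decidable-stable (_ ℚ.≤? _) λ ¬goal →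
    ¬¬-Fin (λ i → ¬¬-Cube n λ x → ¬¬-excluded-middle) λ hits? →
    ¬¬-Fin (λ i → ¬¬-Fin λ j → ¬¬-Cube n λ x → ¬¬-excluded-middle) λ meets? →
    ¬goal (decided hits? meets?)
    where
    P : Fin (length Ps) → Lin G n
    P = lookup Ps
    -- Indexing by list positions leaves only finitely many equalities to decide.
    is = allFin (length Ps)
    decided : (∀ i x → Dec (f x ≈ evalLin G (P i) x)) →
              (∀ i j x → Dec (evalLin G (P i) x ≈ evalLin G (P j) x)) →
              toℚ (length Ps) ℚ.≤ _
    decided hits? meets? = length-bound ε (length Ps) (2 ^ n) {{m^n≢0 2 n}} (begin
      toℚ (length Ps) ℚ.* (q ℚ.* q)   ≡⟨ cong (λ l → toℚ l ℚ.* (q ℚ.* q)) (length-tabulate {n = length Ps} (λ i → i)) ⟨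
      toℚ (length is) ℚ.* (q ℚ.* q)   ≤⟨ length*≤sum (λ i → sq (bias 𝓕 i)) (q ℚ.* q) (All.universal biased is) ⟩
      toℚ (sum (map (λ i → sq (bias 𝓕 i)) is)) ≤⟨ toℚ-mono (sqBiasBound n 𝓕 is is-distinct) ⟩
      toℚ (sq (2 ^ n)) ∎)
      where
      open ℚ.≤-Reasoning
      q = (ε ℚ.+ ε) ℚ.* toℚ (2 ^ n)
      𝓕 : Family n (Fin (length Ps))
      𝓕 = record { target = f ; member = λ i → evalLin G (P i) ; affine = λ i → evalLin-affine (P i)
                 ; hits? = hits? ; meets? = meets? }
      is-distinct : Distinct 𝓕 is
      is-distinct = AllPairsₚ.map⁻ (subst (AllPairs (λ P Q → ¬ SameFun G P Q))
        (sym (trans (map-tabulate (λ i → i) P) (tabulate-lookup Ps))) distinct)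
      q-nonNeg : NonNegative q
      q-nonNeg = ℚ.nonNeg*nonNeg⇒nonNeg (ε ℚ.+ ε) {{ℚ.nonNeg+nonNeg⇒nonNeg ε {{ℚ.pos⇒nonNeg ε}} ε {{ℚ.pos⇒nonNeg ε}}}}
                   (toℚ (2 ^ n)) {{toℚ-nonNeg (2 ^ n)}}
      biased : ∀ i → q ℚ.* q ℚ.≤ toℚ (sq (bias 𝓕 i))
      biased i with All.lookup close (∈-lookup {xs = Ps} i)
      ... | S , agree , small = ℚ.≤-trans
        (ℚ-sq-mono {{q-nonNeg}} (close⇒biased ε (2 ^ n) (count n S) (agreement 𝓕 i) covered small))
        (ℚ.≤-reflexive (sym (toℚ-* (bias 𝓕 i) (bias 𝓕 i))))
        where
        -- Outside the witness `S` the functions agree, so `S` and the agreement set cover the cube.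
        covered : 2 ^ n ≤ count n S + agreement 𝓕 i
        covered = subst (λ s → 2 ^ n ≤ s + agreement 𝓕 i) (sym (count≡card n S))
                    (card-cover n (λ x Sx → fromWitness (agree x Sx)))

theorem1p2 : ∃Poly λ p →
    (ε : ℚ) → .{{_ : Positive ε}} →
    {c ℓ : Level} (G : AbelianGroup c ℓ) →
    (n : ℕ) → 1 ≤ n →
    (f : Cube n → AbelianGroup.Carrier G) →
    AtMostCloseTo G n f (½ - ε) (evalPoly p ((1/ ε) {{pos⇒nonZero ε}}))
theorem1p2 = (0ℚ ∷ 0ℚ ∷ ¼ ∷ []) , λ ε G n _ f → list-bound G ε n f
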